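{- Let $n$ be a non-negative integer, let $a,x$ be non-zero complex numbers, and let $\lambda\in\mathbb{C}$ satisfy $\lambda\ne 0$ and $(\lambda;\lambda)_n\neq 0$. Then $$\frac{1}{x^n}=\frac{1}{a^n}\sum_{k=0}^n(-1)^k\lambda^{\binom{k}{2}}\genfrac{[}{]}{0pt}{}{n}{k}_{\lambda}(x-a)_\lambda^k.$$
   Context: $(x-a)_\lambda^0=1$ and $(x-a)_\lambda^k=\prod_{j=0}^{k-1}\left(1-\frac{a}{\lambda^j x}\right)$ for $k\ge 1$ (not an ordinary power). $(q;q)_0=1$, $(q;q)_m=\prod_{j=1}^m(1-q^j)$, and the $q$-binomial coefficient is $\genfrac{[}{]}{0pt}{}{n}{k}_{q}=\frac{(q;q)_n}{(q;q)_k(q;q)_{n-k}}$. -}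

module Defs where

open import Level using (0ℓ)
open import Algebra.Apartness.Bundles using (HeytingCommutativeRing; HeytingField)
open import Algebra.Bundles using (CommutativeRing; Semiring)
open import Data.Fin.Base using (Fin; zero; suc; toℕ; inject≤)
open import Data.Fin.Properties using (toℕ-inject≤)
open import Data.Nat.Base as ℕ using (ℕ; zero; suc; _∸_)
import Data.Nat.Properties as ℕₚ
open import Data.Product.Base using (∃-syntax; _×_; _,_; proj₁; proj₂)
open import Data.Rational.Base as Rat using (ℚ; 0ℚ; 1ℚ; ½; ∣_∣)
import Data.Rational.Properties as ℚₚ
open import Data.Rational.Solver using (module +-*-Solver)
open import Data.Sum.Base as Sum using (_⊎_; inj₁; inj₂)
open import Relation.Binary.Bundles using (Setoid)
open import Relation.Binary.Structures using (IsEquivalence)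
open import Relation.Nullary using (¬_; yes; no; contradiction)

module Estimates where
  open import Relation.Binary.PropositionalEquality using (_≡_; refl; sym; trans; cong; cong₂; subst)
  open Rat hiding (ℚ; 0ℚ; 1ℚ; ½; ∣_∣)
  open ℚₚ
  open ℚₚ.≤-Reasoning

  0<½* : ∀ {ε} → 0ℚ < ε → 0ℚ < ½ * ε
  0<½* {ε} p = positive⁻¹ (½ * ε) {{pos*pos⇒pos ½ ε {{positive p}}}}

  0<* : ∀ {p q} → 0ℚ < p → 0ℚ < q → 0ℚ < p * q
  0<* {p} {q} a b = positive⁻¹ (p * q) {{pos*pos⇒pos p {{positive a}} q {{positive b}}}}

  halves : ∀ ε → ½ * ε + ½ * ε ≡ ε
  halves ε = trans (sym (*-distribʳ-+ ε ½ ½)) (*-identityˡ ε)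

  divide : ∀ {M} ε → 0ℚ < M → 0ℚ < ε → ∃[ δ ] (0ℚ < δ × M * δ ≡ ε)
  divide {M} ε 0<M 0<ε = 1/ M * ε , 0<* 0<1/M 0<ε , eq
    where
    instance
      _ = positive 0<M
      _ = pos⇒nonZero M
    0<1/M = positive⁻¹ (1/ M) {{1/pos⇒pos M}}
    eq : M * (1/ M * ε) ≡ ε
    eq = trans (sym (*-assoc M (1/ M) ε)) (trans (cong (_* ε) (*-inverseʳ M)) (*-identityˡ ε))

  ∣p-p∣<ε : ∀ {p q ε} → p ≡ q → 0ℚ < ε → ∣ p - q ∣ < ε
  ∣p-p∣<ε {p} refl 0<ε = subst (_< _) (cong ∣_∣ (sym (+-inverseʳ p))) 0<ε

  ∣-∣-sym : ∀ p q → ∣ p - q ∣ ≡ ∣ q - p ∣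
  ∣-∣-sym p q = trans (sym (∣-p∣≡∣p∣ (p - q))) (cong ∣_∣ (solve 2 (λ p q → :- (p :- q) := q :- p) refl p q))
    where open +-*-Solver

  +-< : ∀ {p q δ ε} → ∣ p ∣ < δ → ∣ q ∣ < ε → ∣ p + q ∣ < δ + ε
  +-< {p} {q} a b = ≤-<-trans (∣p+q∣≤∣p∣+∣q∣ p q) (+-mono-< a b)

  +-<-½ : ∀ {p q ε} → ∣ p ∣ < ½ * ε → ∣ q ∣ < ½ * ε → ∣ p + q ∣ < ε
  +-<-½ {ε = ε} a b = subst (_ <_) (halves ε) (+-< a b)

  triangle : ∀ {p q r ε} → ∣ p - q ∣ < ½ * ε → ∣ q - r ∣ < ½ * ε → ∣ p - r ∣ < ε
  triangle {p} {q} {r} a b = subst (_< _) (cong ∣_∣ eq) (+-<-½ a b)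
    where
    open +-*-Solver
    eq : (p - q) + (q - r) ≡ p - r
    eq = solve 3 (λ p q r → (p :- q) :+ (q :- r) := p :- r) refl p q r

  +-close : ∀ {p q r s ε} → ∣ p - r ∣ < ½ * ε → ∣ q - s ∣ < ½ * ε → ∣ (p + q) - (r + s) ∣ < ε
  +-close {p} {q} {r} {s} a b = subst (_< _) (cong ∣_∣ eq) (+-<-½ a b)
    where
    open +-*-Solver
    eq : (p - r) + (q - s) ≡ (p + q) - (r + s)
    eq = solve 4 (λ p q r s → (p :- r) :+ (q :- s) := (p :+ q) :- (r :+ s)) refl p q r s

  neg-close : ∀ {p q ε} → ∣ p - q ∣ < ε → ∣ - p - - q ∣ < ε
  neg-close {p} {q} a = subst (_< _) (trans (∣-∣-sym p q) (cong ∣_∣ eq)) a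
    where
    open +-*-Solver
    eq : q - p ≡ - p - - q
    eq = solve 2 (λ p q → q :- p := :- p :- :- q) refl p q

  *-< : ∀ {p q M δ} → ∣ p ∣ < M → ∣ q ∣ < δ → ∣ p * q ∣ < M * δ
  *-< {p} {q} {M} {δ} a b = begin-strict
    ∣ p * q ∣      ≡⟨ ∣p*q∣≡∣p∣*∣q∣ p q ⟩
    ∣ p ∣ * ∣ q ∣  ≤⟨ *-monoʳ-≤-nonNeg ∣ q ∣ {{∣-∣-nonNeg q}} (<⇒≤ a) ⟩
    M * ∣ q ∣      <⟨ *-monoʳ-<-pos M {{positive (≤-<-trans (0≤∣p∣ p) a)}} b ⟩
    M * δ          ∎

  *-close : ∀ {p q r s M δ ε} → ∣ p ∣ < M → ∣ s ∣ < M → M * δ ≡ ½ * ε →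
            ∣ p - r ∣ < δ → ∣ q - s ∣ < δ → ∣ p * q - r * s ∣ < ε
  *-close {p} {q} {r} {s} p<M s<M Mδ a b =
    subst (_< _) (cong ∣_∣ eq)
      (+-<-½ (subst (_ <_) Mδ (*-< p<M b)) (subst (_ <_) Mδ (*-< s<M a)))
    where
    open +-*-Solver
    eq : p * (q - s) + s * (p - r) ≡ p * q - r * s
    eq = solve 4 (λ p q r s → p :* (q :- s) :+ s :* (p :- r) := p :* q :- r :* s) refl p q r s

  close⇒bounded : ∀ {p q} → ∣ p - q ∣ < 1ℚ → ∣ p ∣ < 1ℚ + ∣ q ∣
  close⇒bounded {p} {q} a = begin-strict
    ∣ p ∣               ≡⟨ cong ∣_∣ (solve 2 (λ p q → p := (p :- q) :+ q) refl p q) ⟩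
    ∣ (p - q) + q ∣     ≤⟨ ∣p+q∣≤∣p∣+∣q∣ (p - q) q ⟩
    ∣ p - q ∣ + ∣ q ∣   <⟨ +-monoˡ-< ∣ q ∣ a ⟩
    1ℚ + ∣ q ∣          ∎
    where open +-*-Solver

  <-grow₁ : ∀ {r p q} → r < p → 0ℚ < q → r < p + q
  <-grow₁ {r} {p} {q} r<p 0<q = subst (_< p + q) (+-identityʳ r) (+-mono-< r<p 0<q)

  <-grow₂ : ∀ {r p q} → r < p → 0ℚ < q → r < q + p
  <-grow₂ {r} {p} {q} r<p 0<q = subst (_< q + p) (+-identityˡ r) (+-mono-< 0<q r<p)

  stay-away : ∀ {p q η} → η ≤ ∣ p ∣ → ∣ p - q ∣ < ½ * η → ½ * η ≤ ∣ q ∣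
  stay-away {p} {q} η≤p a = ≮⇒≥ λ q<½η → <-irrefl refl
    (≤-<-trans η≤p (subst (_< _) (cong ∣_∣ eq) (+-<-½ a q<½η)))
    where
    open +-*-Solver
    eq : (p - q) + q ≡ p
    eq = solve 2 (λ p q → (p :- q) :+ q := p) refl p q

  cofactor-away : ∀ {p q M δ} → ∣ p * q - 1ℚ ∣ < ½ → ∣ p ∣ < M → M * δ ≡ ½ → δ ≤ ∣ q ∣
  cofactor-away {p} {q} a p<M Mδ = ≮⇒≥ λ q<δ → <-irrefl refl
    (≤-<-trans (stay-away {1ℚ} {p * q} ≤-refl (subst (_< ½) (∣-∣-sym (p * q) 1ℚ) a))
               (subst (_ <_) Mδ (*-< p<M q<δ)))

  0≤p² : ∀ p → 0ℚ ≤ p * p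
  0≤p² p with ≤-total 0ℚ p
  ... | inj₁ 0≤p = nonNegative⁻¹ (p * p) {{nonNeg*nonNeg⇒nonNeg p {{nonNegative 0≤p}} p {{nonNegative 0≤p}}}}
  ... | inj₂ p≤0 = nonNegative⁻¹ (p * p) {{nonPos*nonPos⇒nonPos p {{nonPositive p≤0}} p {{nonPositive p≤0}}}}

  sum-of-squares : ∀ {p q η} → 0ℚ < η → η ≤ ∣ p ∣ → η * η ≤ ∣ p * p + q * q ∣
  sum-of-squares {p} {q} {η} 0<η η≤p = begin
    η * η                ≤⟨ *-monoʳ-≤-nonNeg η {{pos⇒nonNeg η {{positive 0<η}}}} η≤p ⟩
    ∣ p ∣ * η            ≤⟨ *-monoˡ-≤-nonNeg ∣ p ∣ {{∣-∣-nonNeg p}} η≤p ⟩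
    ∣ p ∣ * ∣ p ∣        ≡⟨ ∣p*q∣≡∣p∣*∣q∣ p p ⟨
    ∣ p * p ∣            ≡⟨ 0≤p⇒∣p∣≡p (0≤p² p) ⟩
    p * p                ≡⟨ +-identityʳ (p * p) ⟨
    p * p + 0ℚ           ≤⟨ +-monoʳ-≤ (p * p) (0≤p² q) ⟩
    p * p + q * q        ≡⟨ 0≤p⇒∣p∣≡p (≤-trans (0≤p² p) pp≤) ⟨
    ∣ p * p + q * q ∣    ∎
    where
    pp≤ : p * p ≤ p * p + q * q
    pp≤ = subst (_≤ p * p + q * q) (+-identityʳ (p * p)) (+-monoʳ-≤ (p * p) (0≤p² q))

  -- The reciprocal on ℚ extended by the junk value 0; it is only used on
  -- sequences that are eventually bounded away from 0.
  recip : ℚ → ℚ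
  recip p with p ≟ 0ℚ
  ... | yes _ = 0ℚ
  ... | no p≢0 = (1/ p) {{≢-nonZero p≢0}}

  *-recip : ∀ {p ε} → 0ℚ < ε → ε ≤ ∣ p ∣ → p * recip p ≡ 1ℚ
  *-recip {p} 0<ε ε≤∣p∣ with p ≟ 0ℚ
  ... | yes refl = contradiction (<-≤-trans 0<ε ε≤∣p∣) (<-irrefl refl)
  ... | no p≢0 = *-inverseʳ p {{≢-nonZero p≢0}}

  recip-bound : ∀ {p ε} → 0ℚ < ε → ε ≤ ∣ p ∣ → ∣ recip p ∣ * ε ≤ 1ℚ
  recip-bound {p} {ε} 0<ε ε≤∣p∣ = begin
    ∣ recip p ∣ * ε        ≤⟨ *-monoˡ-≤-nonNeg ∣ recip p ∣ {{∣-∣-nonNeg (recip p)}} ε≤∣p∣ ⟩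
    ∣ recip p ∣ * ∣ p ∣    ≡⟨ *-comm ∣ recip p ∣ ∣ p ∣ ⟩
    ∣ p ∣ * ∣ recip p ∣    ≡⟨ ∣p*q∣≡∣p∣*∣q∣ p (recip p) ⟨
    ∣ p * recip p ∣        ≡⟨ cong ∣_∣ (*-recip 0<ε ε≤∣p∣) ⟩
    1ℚ                     ∎

  recip-close : ∀ {p q η δ ε} → 0ℚ < η → 0ℚ < δ → η * η * ε ≡ δ → η ≤ ∣ p ∣ → η ≤ ∣ q ∣ →
                ∣ p - q ∣ < δ → ∣ recip p - recip q ∣ < ε
  recip-close {p} {q} {η} {δ} {ε} 0<η 0<δ eq ηp ηq a =
    *-cancelˡ-<-nonNeg (η * η) {{pos⇒nonNeg (η * η) {{positive (0<* 0<η 0<η)}}}} (begin-strict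
    η * η * ∣ u - v ∣                     ≡⟨ cong (λ t → η * η * t) lem ⟩
    η * η * (∣ u ∣ * ∣ v ∣ * ∣ p - q ∣)   ≡⟨ solve 4 (λ a b c d → a :* a :* (b :* c :* d) := (b :* a) :* ((c :* a) :* d)) refl η (∣ u ∣) (∣ v ∣) (∣ p - q ∣) ⟩
    ∣ u ∣ * η * (∣ v ∣ * η * ∣ p - q ∣)   ≤⟨ *-monoʳ-≤-nonNeg (∣ v ∣ * η * ∣ p - q ∣) {{nn₂}} (recip-bound 0<η ηp) ⟩
    1ℚ * (∣ v ∣ * η * ∣ p - q ∣)          ≡⟨ *-identityˡ _ ⟩
    ∣ v ∣ * η * ∣ p - q ∣                 ≤⟨ *-monoʳ-≤-nonNeg ∣ p - q ∣ {{∣-∣-nonNeg (p - q)}} (recip-bound 0<η ηq) ⟩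
    1ℚ * ∣ p - q ∣                        ≡⟨ *-identityˡ _ ⟩
    ∣ p - q ∣                             <⟨ a ⟩
    δ                                     ≡⟨ eq ⟨
    η * η * ε                             ∎)
    where
    open +-*-Solver
    u = recip p
    v = recip q
    nn₁ : NonNegative (∣ v ∣ * η)
    nn₁ = nonNeg*nonNeg⇒nonNeg ∣ v ∣ {{∣-∣-nonNeg v}} η {{pos⇒nonNeg η {{positive 0<η}}}}
    nn₂ : NonNegative (∣ v ∣ * η * ∣ p - q ∣)
    nn₂ = nonNeg*nonNeg⇒nonNeg (∣ v ∣ * η) {{nn₁}} ∣ p - q ∣ {{∣-∣-nonNeg (p - q)}}
    expand : u - v ≡ u * v * (q - p)
    expand = trans
      (cong₂ _-_ (trans (sym (*-identityʳ u)) (cong (u *_) (sym (*-recip 0<η ηq))))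
                 (trans (sym (*-identityʳ v)) (cong (v *_) (sym (*-recip 0<η ηp)))))
      (solve 4 (λ p q u v → u :* (q :* v) :- v :* (p :* u) := u :* v :* (q :- p)) refl p q u v)
    lem : ∣ u - v ∣ ≡ ∣ u ∣ * ∣ v ∣ * ∣ p - q ∣
    lem = trans (cong ∣_∣ expand) (trans (∣p*q∣≡∣p∣*∣q∣ (u * v) (q - p))
      (cong₂ _*_ (∣p*q∣≡∣p∣*∣q∣ u v) (∣-∣-sym q p)))

Eventually : (ℕ → Set) → Set
Eventually P = ∃[ N ] (∀ n → N ℕ.≤ n → P n)

Eventually₂ : (ℕ → ℕ → Set) → Set
Eventually₂ P = ∃[ N ] (∀ m n → N ℕ.≤ m → N ℕ.≤ n → P m n)

private
  map₁ : ∀ {P Q : ℕ → Set} → Eventually P → (∀ {n} → P n → Q n) → Eventually Q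
  map₁ (N , p) f = N , λ n le → f (p n le)

  zip₁ : ∀ {P Q R : ℕ → Set} → Eventually P → Eventually Q → (∀ {n} → P n → Q n → R n) → Eventually R
  zip₁ (M , p) (N , q) f = M ℕ.⊔ N , λ n le →
    f (p n (ℕₚ.m⊔n≤o⇒m≤o M N le)) (q n (ℕₚ.m⊔n≤o⇒n≤o M N le))

  map₂ : ∀ {P Q : ℕ → ℕ → Set} → Eventually₂ P → (∀ {m n} → P m n → Q m n) → Eventually₂ Q
  map₂ (N , p) f = N , λ m n l l′ → f (p m n l l′)

  zip₂ : ∀ {P Q R : ℕ → ℕ → Set} → Eventually₂ P → Eventually₂ Q →
         (∀ {m n} → P m n → Q m n → R m n) → Eventually₂ R
  zip₂ (M , p) (N , q) f = M ℕ.⊔ N , λ m n l l′ →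
    f (p m n (ℕₚ.m⊔n≤o⇒m≤o M N l) (ℕₚ.m⊔n≤o⇒m≤o M N l′))
      (q m n (ℕₚ.m⊔n≤o⇒n≤o M N l) (ℕₚ.m⊔n≤o⇒n≤o M N l′))

  both : ∀ {P : ℕ → Set} → Eventually P → Eventually₂ (λ m n → P m × P n)
  both (N , p) = N , λ m n l l′ → p m l , p n l′

module Real where
  open import Relation.Binary.PropositionalEquality using (_≡_; refl; sym; trans; cong; subst)
  open Rat using (_<_; _≤_)
  open Estimates

  -- Cauchy sequences of rationals, compared up to null differences.
  record ℝ : Set where
    no-eta-equality
    field
      seq    : ℕ → ℚ
      cauchy : ∀ ε → 0ℚ < ε → Eventually₂ (λ m n → ∣ seq m Rat.- seq n ∣ < ε)
  open ℝ public

  infix  4 _≈_ _#_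
  infixl 6 _+_ _-_
  infixl 7 _*_
  infix  8 -_

  record _≈_ (x y : ℝ) : Set where
    constructor mk≈
    field
      close : ∀ ε → 0ℚ < ε → Eventually (λ n → ∣ seq x n Rat.- seq y n ∣ < ε)
  open _≈_ public

  -- x # y is the positive form of x ≉ y: the difference is eventually bounded
  -- away from 0.  It is tight (¬#⇒≈) and, by #⇒invertible and invertible⇒#,
  -- x # 0ℝ says exactly that x has a reciprocal.
  record _#_ (x y : ℝ) : Set where
    constructor mk#
    field
      gap      : ℚ
      0<gap    : 0ℚ < gap
      separate : Eventually (λ n → gap ≤ ∣ seq x n Rat.- seq y n ∣)
  open _#_ public

  fromℚ : ℚ → ℝ
  fromℚ p .seq _ = p
  fromℚ p .cauchy ε 0<ε = 0 , λ _ _ _ _ → ∣p-p∣<ε {p} refl 0<ε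

  0ℝ 1ℝ : ℝ
  0ℝ = fromℚ 0ℚ
  1ℝ = fromℚ 1ℚ

  _+_ : ℝ → ℝ → ℝ
  (x + y) .seq n = seq x n Rat.+ seq y n
  (x + y) .cauchy ε 0<ε =
    zip₂ (cauchy x (½ Rat.* ε) (0<½* 0<ε)) (cauchy y (½ Rat.* ε) (0<½* 0<ε))
      λ {m} {n} → +-close {seq x m} {seq y m} {seq x n} {seq y n} {ε}

  -_ : ℝ → ℝ
  (- x) .seq n = Rat.- seq x n
  (- x) .cauchy ε 0<ε = map₂ (cauchy x ε 0<ε) λ {m} {n} → neg-close {seq x m} {seq x n}

  _-_ : ℝ → ℝ → ℝ
  x - y = x + - y

  record EventualBound (x : ℝ) : Set where
    constructor mkBound
    field
      bound   : ℚ
      0<bound : 0ℚ < bound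
      below   : Eventually (λ n → ∣ seq x n ∣ < bound)

  bounded : ∀ x → EventualBound x
  bounded x =
    let N , c = cauchy x 1ℚ (ℚₚ.positive⁻¹ 1ℚ) in mkBound (1ℚ Rat.+ ∣ seq x N ∣)
    (ℚₚ.≤-<-trans (ℚₚ.0≤∣p∣ (seq x N)) (close⇒bounded {seq x N} {seq x N} (c N N ℕₚ.≤-refl ℕₚ.≤-refl)))
    (N , λ n le → close⇒bounded {seq x n} {seq x N} (c n N le ℕₚ.≤-refl))

  record CommonBound (x y : ℝ) : Set where
    constructor mkCommonBound
    field
      bound   : ℚ
      0<bound : 0ℚ < bound
      below   : Eventually (λ n → ∣ seq x n ∣ < bound × ∣ seq y n ∣ < bound)

  bounded₂ : ∀ x y → CommonBound x y
  bounded₂ x y = mkCommonBound (M Rat.+ M′) (<-grow₁ {0ℚ} {M} {M′} X.0<bound Y.0<bound)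
    (zip₁ X.below Y.below λ {n} l l′ →
      <-grow₁ {∣ seq x n ∣} {M} {M′} l Y.0<bound , <-grow₂ {∣ seq y n ∣} {M′} {M} l′ X.0<bound)
    where
    module X = EventualBound (bounded x)
    module Y = EventualBound (bounded y)
    M = X.bound
    M′ = Y.bound

  _*_ : ℝ → ℝ → ℝ
  (x * y) .seq n = seq x n Rat.* seq y n
  (x * y) .cauchy ε 0<ε =
      let mkCommonBound M 0<M b = bounded₂ x y
          δ , 0<δ , Mδ = divide {M} (½ Rat.* ε) 0<M (0<½* 0<ε)
      in
      zip₂ (both b) (zip₂ (cauchy x δ 0<δ) (cauchy y δ 0<δ) _,_)
        λ { {m} {n} ((l , _) , (_ , l′)) (c , c′) →
            *-close {seq x m} {seq y m} {seq x n} {seq y n} {M} {δ} {ε} l l′ Mδ c c′ }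

  ≗⇒≈ : ∀ {x y} → (∀ n → seq x n ≡ seq y n) → x ≈ y
  ≗⇒≈ {x} {y} eq = mk≈ λ ε 0<ε → 0 , λ n _ → ∣p-p∣<ε {seq x n} {seq y n} (eq n) 0<ε

  ≈-refl : ∀ {x} → x ≈ x
  ≈-refl = ≗⇒≈ λ _ → refl

  ≈-sym : ∀ {x y} → x ≈ y → y ≈ x
  ≈-sym {x} {y} (mk≈ c) = mk≈ λ ε 0<ε →
    map₁ (c ε 0<ε) λ {n} → subst (_< ε) (∣-∣-sym (seq x n) (seq y n))

  ≈-trans : ∀ {x y z} → x ≈ y → y ≈ z → x ≈ z
  ≈-trans {x} {y} {z} (mk≈ c) (mk≈ d) = mk≈ λ ε 0<ε →
    zip₁ (c (½ Rat.* ε) (0<½* 0<ε)) (d (½ Rat.* ε) (0<½* 0<ε))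
      λ {n} → triangle {seq x n} {seq y n} {seq z n} {ε}

  +-cong : ∀ {x y u v} → x ≈ y → u ≈ v → x + u ≈ y + v
  +-cong {x} {y} {u} {v} (mk≈ c) (mk≈ d) = mk≈ λ ε 0<ε →
    zip₁ (c (½ Rat.* ε) (0<½* 0<ε)) (d (½ Rat.* ε) (0<½* 0<ε))
      λ {n} → +-close {seq x n} {seq u n} {seq y n} {seq v n} {ε}

  -‿cong : ∀ {x y} → x ≈ y → - x ≈ - y
  -‿cong {x} {y} (mk≈ c) = mk≈ λ ε 0<ε → map₁ (c ε 0<ε) λ {n} → neg-close {seq x n} {seq y n}

  *-cong : ∀ {x y u v} → x ≈ y → u ≈ v → x * u ≈ y * v
  *-cong {x} {y} {u} {v} (mk≈ c) (mk≈ d) = mk≈ prf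
    where
    prf : ∀ ε → 0ℚ < ε → Eventually (λ n → ∣ seq x n Rat.* seq u n Rat.- seq y n Rat.* seq v n ∣ < ε)
    prf ε 0<ε =
      let mkCommonBound M 0<M b = bounded₂ x v
          δ , 0<δ , Mδ = divide {M} (½ Rat.* ε) 0<M (0<½* 0<ε)
      in
      zip₁ b (zip₁ (c δ 0<δ) (d δ 0<δ) _,_)
        λ { {n} (l , l′) (e , e′) →
            *-close {seq x n} {seq u n} {seq y n} {seq v n} {M} {δ} {ε} l l′ Mδ e e′ }

  private
    +-assoc : ∀ x y z → (x + y) + z ≈ x + (y + z)
    +-assoc x y z = ≗⇒≈ λ n → ℚₚ.+-assoc (seq x n) (seq y n) (seq z n)

    +-comm : ∀ x y → x + y ≈ y + x
    +-comm x y = ≗⇒≈ λ n → ℚₚ.+-comm (seq x n) (seq y n)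

    +-identityˡ : ∀ x → 0ℝ + x ≈ x
    +-identityˡ x = ≗⇒≈ λ n → ℚₚ.+-identityˡ (seq x n)

    +-inverseˡ : ∀ x → - x + x ≈ 0ℝ
    +-inverseˡ x = ≗⇒≈ λ n → ℚₚ.+-inverseˡ (seq x n)

    *-assoc : ∀ x y z → (x * y) * z ≈ x * (y * z)
    *-assoc x y z = ≗⇒≈ λ n → ℚₚ.*-assoc (seq x n) (seq y n) (seq z n)

    *-comm : ∀ x y → x * y ≈ y * x
    *-comm x y = ≗⇒≈ λ n → ℚₚ.*-comm (seq x n) (seq y n)

    *-identityˡ : ∀ x → 1ℝ * x ≈ x
    *-identityˡ x = ≗⇒≈ λ n → ℚₚ.*-identityˡ (seq x n)

    *-distribʳ-+ : ∀ x y z → (y + z) * x ≈ y * x + z * x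
    *-distribʳ-+ x y z = ≗⇒≈ λ n → ℚₚ.*-distribʳ-+ (seq x n) (seq y n) (seq z n)

    +-identityʳ : ∀ x → x + 0ℝ ≈ x
    +-identityʳ x = ≗⇒≈ λ n → ℚₚ.+-identityʳ (seq x n)

    +-inverseʳ : ∀ x → x + - x ≈ 0ℝ
    +-inverseʳ x = ≗⇒≈ λ n → ℚₚ.+-inverseʳ (seq x n)

    *-identityʳ : ∀ x → x * 1ℝ ≈ x
    *-identityʳ x = ≗⇒≈ λ n → ℚₚ.*-identityʳ (seq x n)

    *-distribˡ-+ : ∀ x y z → x * (y + z) ≈ x * y + x * z
    *-distribˡ-+ x y z = ≗⇒≈ λ n → ℚₚ.*-distribˡ-+ (seq x n) (seq y n) (seq z n)

  commutativeRing : CommutativeRing 0ℓ 0ℓ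
  commutativeRing = record
    { Carrier = ℝ ; _≈_ = _≈_ ; _+_ = _+_ ; _*_ = _*_ ; -_ = -_ ; 0# = 0ℝ ; 1# = 1ℝ
    ; isCommutativeRing = record
      { isRing = record
        { +-isAbelianGroup = record
          { isGroup = record
            { isMonoid = record
              { isSemigroup = record
                { isMagma = record
                  { isEquivalence = record { refl = ≈-refl ; sym = ≈-sym ; trans = ≈-trans }
                  ; ∙-cong = +-cong }
                ; assoc = +-assoc }
              ; identity = +-identityˡ , +-identityʳ }
            ; inverse = +-inverseˡ , +-inverseʳ
            ; ⁻¹-cong = -‿cong }
          ; comm = +-comm }
        ; *-cong = *-cong
        ; *-assoc = *-assoc
        ; *-identity = *-identityˡ , *-identityʳ
        ; distrib = *-distribˡ-+ , *-distribʳ-+ }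
      ; *-comm = *-comm } }

  #-from-index : ∀ {x y} η N → 0ℚ < η →
    (∀ n → N ℕ.≤ n → ∣ seq (x - y) N Rat.- seq (x - y) n ∣ < ½ Rat.* η) →
    η ≤ ∣ seq (x - y) N ∣ → x # y
  #-from-index {x} {y} η N 0<η c a = mk# (½ Rat.* η) (0<½* 0<η) (N , λ n le →
    stay-away {seq (x - y) N} {seq (x - y) n} a (c n le))

  #-irrefl : ∀ {x y} → x ≈ y → ¬ x # y
  #-irrefl (mk≈ c) (mk# η 0<η s) =
    let N , p = zip₁ (c η 0<η) s ℚₚ.<-≤-trans in ℚₚ.<-irrefl refl (p N ℕₚ.≤-refl)

  #-sym : ∀ {x y} → x # y → y # x
  #-sym {x} {y} (mk# η 0<η s) = mk# η 0<η
    (map₁ s λ {n} → subst (η ≤_) (∣-∣-sym (seq x n) (seq y n)))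

  #-cotrans : ∀ {x y} → x # y → ∀ z → (x # z) ⊎ (z # y)
  #-cotrans {x} {y} (mk# η 0<η (N₁ , s)) z = decide (½ Rat.* η ℚₚ.≤? ∣ seq (x - z) N ∣)
    where
    0<½η = 0<½* 0<η
    near : Eventually₂ (λ m n → ∣ seq (x - z) m Rat.- seq (x - z) n ∣ < ½ Rat.* (½ Rat.* η)
                              × ∣ seq (z - y) m Rat.- seq (z - y) n ∣ < ½ Rat.* (½ Rat.* η))
    near = zip₂ (cauchy (x - z) _ (0<½* 0<½η)) (cauchy (z - y) _ (0<½* 0<½η)) _,_
    N = N₁ ℕ.⊔ proj₁ near
    N₁≤N = ℕₚ.m≤m⊔n N₁ (proj₁ near)
    N₂≤N = ℕₚ.m≤n⊔m N₁ (proj₁ near)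
    near′ = λ n (le : N ℕ.≤ n) → proj₂ near N n N₂≤N (ℕₚ.≤-trans N₂≤N le)
    telescope : ∀ p q r → (p Rat.- r) Rat.+ (r Rat.- q) ≡ p Rat.- q
    telescope = solve 3 (λ p q r → (p :- r) :+ (r :- q) := p :- q) refl
      where open +-*-Solver
    decide : _ → (x # z) ⊎ (z # y)
    decide (yes a) = inj₁ (#-from-index _ N 0<½η (λ n le → proj₁ (near′ n le)) a)
    decide (no ¬a) = inj₂ (#-from-index _ N 0<½η (λ n le → proj₂ (near′ n le))
      (ℚₚ.≮⇒≥ λ b → ℚₚ.<-irrefl refl (ℚₚ.≤-<-trans (s N N₁≤N)
        (subst (_< η) (cong ∣_∣ (telescope (seq x N) (seq y N) (seq z N)))
          (+-<-½ {seq (x - z) N} {seq (z - y) N} (ℚₚ.≰⇒> ¬a) b)))))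

  ¬#⇒≈ : ∀ {x y} → ¬ x # y → x ≈ y
  ¬#⇒≈ {x} {y} ¬x#y = mk≈ prf
    where
    prf : ∀ ε → 0ℚ < ε → Eventually (λ n → ∣ seq x n Rat.- seq y n ∣ < ε)
    prf ε 0<ε =
      let N , c = cauchy (x - y) (½ Rat.* ε) (0<½* 0<ε) in N , λ n le → ℚₚ.≰⇒> λ ε≤ →
      ¬x#y (#-from-index ε n 0<ε (λ m n≤m → c n m le (ℕₚ.≤-trans le n≤m)) ε≤)

  reciprocal : ∀ x → (∃[ η ] (0ℚ < η × Eventually (λ n → η ≤ ∣ seq x n ∣))) → ℝ
  reciprocal x _ .seq n = recip (seq x n)
  reciprocal x (η , 0<η , s) .cauchy ε 0<ε =
    zip₂ (both s) (cauchy x (η Rat.* η Rat.* ε) (0<* (0<* 0<η 0<η) 0<ε))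
      λ { {m} {n} (a , b) → recip-close {seq x m} {seq x n} {η} {η Rat.* η Rat.* ε} {ε}
            0<η (0<* (0<* 0<η 0<η) 0<ε) refl a b }

  #⇒invertible : ∀ {x y} → x # y → ∃[ z ] ((z * (x - y) ≈ 1ℝ) × ((x - y) * z ≈ 1ℝ))
  #⇒invertible {x} {y} (mk# η 0<η s) = z , ≈-trans (≗⇒≈ λ n → ℚₚ.*-comm (seq z n) (seq (x - y) n)) right , right
    where
    z = reciprocal (x - y) (η , 0<η , s)
    right : (x - y) * z ≈ 1ℝ
    right = mk≈ λ ε 0<ε → map₁ s λ {n} a →
      ∣p-p∣<ε {seq (x - y) n Rat.* recip (seq (x - y) n)} {1ℚ} (*-recip {seq (x - y) n} 0<η a) 0<ε

  invertible⇒# : ∀ {x y} → ∃[ z ] ((z * (x - y) ≈ 1ℝ) × ((x - y) * z ≈ 1ℝ)) → x # y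
  invertible⇒# {x} {y} (z , mk≈ c , _) =
    let mkBound M 0<M b = bounded z
        δ , 0<δ , Mδ = divide {M} ½ 0<M (ℚₚ.positive⁻¹ ½)
    in mk# δ 0<δ
    (zip₁ (c ½ (ℚₚ.positive⁻¹ ½)) b λ {n} e l →
      cofactor-away {seq z n} {seq (x - y) n} {M} {δ} e l Mδ)

  heytingField : HeytingField 0ℓ 0ℓ 0ℓ
  heytingField = record
    { Carrier = ℝ ; _≈_ = _≈_ ; _#_ = _#_ ; _+_ = _+_ ; _*_ = _*_ ; -_ = -_ ; 0# = 0ℝ ; 1# = 1ℝ
    ; isHeytingField = record
      { isHeytingCommutativeRing = record
        { isCommutativeRing = CommutativeRing.isCommutativeRing commutativeRing
        ; isApartnessRelation = record { irrefl = #-irrefl ; sym = #-sym ; cotrans = #-cotrans }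
        ; #⇒invertible = #⇒invertible
        ; invertible⇒# = invertible⇒# }
      ; tight = λ _ _ → ¬#⇒≈ , #-irrefl } }

  x²+y²#0 : ∀ {x y} → (x # 0ℝ) ⊎ (y # 0ℝ) → x * x + y * y # 0ℝ
  x²+y²#0 {x} {y} (inj₁ (mk# η 0<η s)) = mk# (η Rat.* η) (0<* 0<η 0<η) (map₁ s λ {n} a →
    subst (λ t → η Rat.* η ≤ ∣ t ∣) (sym (ℚₚ.+-identityʳ (sq x n Rat.+ sq y n)))
      (sum-of-squares {seq x n} {seq y n} {η} 0<η
        (subst (λ t → η ≤ ∣ t ∣) (ℚₚ.+-identityʳ (seq x n)) a)))
    where
    sq : ℝ → ℕ → ℚ
    sq z n = seq z n Rat.* seq z n
  x²+y²#0 {x} {y} (inj₂ (mk# η 0<η s)) = mk# (η Rat.* η) (0<* 0<η 0<η) (map₁ s λ {n} a →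
    subst (λ t → η Rat.* η ≤ ∣ t ∣)
      (trans (ℚₚ.+-comm (sq y n) (sq x n)) (sym (ℚₚ.+-identityʳ (sq x n Rat.+ sq y n))))
      (sum-of-squares {seq y n} {seq x n} {η} 0<η
        (subst (λ t → η ≤ ∣ t ∣) (ℚₚ.+-identityʳ (seq y n)) a)))
    where
    sq : ℝ → ℕ → ℚ
    sq z n = seq z n Rat.* seq z n

module HeytingProperties {c ℓ₁ ℓ₂} (F : HeytingField c ℓ₁ ℓ₂) where
  open HeytingField F
    renaming (sym to ≈-sym; trans to ≈-trans)
  open import Algebra.Apartness.Properties.HeytingCommutativeRing heytingCommutativeRing public

  factorˡ#0 : ∀ {x y} → x * y # 0# → x # 0#
  factorˡ#0 {x} {y} xy#0 with #⇒invertible xy#0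
  ... | z , _ , xyz = invertibleʳ⇒# (y * z ,
    ≈-trans (*-congʳ (x-0≈x x)) (≈-trans (≈-sym (*-assoc x y z)) (≈-trans (*-congʳ (≈-sym (x-0≈x (x * y)))) xyz)))

  factorʳ#0 : ∀ {x y} → x * y # 0# → y # 0#
  factorʳ#0 {x} {y} xy#0 = factorˡ#0 (#-congʳ (*-comm x y) xy#0)

  x-y#0⇒x#y : ∀ {x y} → x - y # 0# → x # y
  x-y#0⇒x#y {x} {y} p with #⇒invertible p
  ... | z , _ , inv = invertibleʳ⇒# (z , ≈-trans (*-congʳ (≈-sym (x-0≈x (x - y)))) inv)

  x#y⇒x-y#0 : ∀ {x y} → x # y → x - y # 0#
  x#y⇒x-y#0 {x} {y} p with #⇒invertible p
  ... | z , _ , inv = invertibleʳ⇒# (z , ≈-trans (*-congʳ (x-0≈x (x - y))) inv)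

private
  module GaussianIdentities where
    open Real
    open +-*-Solver
    open import Relation.Binary.PropositionalEquality using (refl)

    assoc-re : ∀ a b c d e f → (a * c - b * d) * e - (a * d + b * c) * f ≈ a * (c * e - d * f) - b * (c * f + d * e)
    assoc-re a b c d e f = ≗⇒≈ λ n → solve 6 (λ a b c d e f →
      (a :* c :- b :* d) :* e :- (a :* d :+ b :* c) :* f := a :* (c :* e :- d :* f) :- b :* (c :* f :+ d :* e)) refl (seq a n) (seq b n) (seq c n) (seq d n) (seq e n) (seq f n)

    assoc-im : ∀ a b c d e f → (a * c - b * d) * f + (a * d + b * c) * e ≈ a * (c * f + d * e) + b * (c * e - d * f)
    assoc-im a b c d e f = ≗⇒≈ λ n → solve 6 (λ a b c d e f →
      (a :* c :- b :* d) :* f :+ (a :* d :+ b :* c) :* e := a :* (c :* f :+ d :* e) :+ b :* (c :* e :- d :* f)) refl (seq a n) (seq b n) (seq c n) (seq d n) (seq e n) (seq f n)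

    distrib-re : ∀ a b c d e f → a * (c + e) - b * (d + f) ≈ (a * c - b * d) + (a * e - b * f)
    distrib-re a b c d e f = ≗⇒≈ λ n → solve 6 (λ a b c d e f →
      a :* (c :+ e) :- b :* (d :+ f) := (a :* c :- b :* d) :+ (a :* e :- b :* f)) refl (seq a n) (seq b n) (seq c n) (seq d n) (seq e n) (seq f n)

    distrib-im : ∀ a b c d e f → a * (d + f) + b * (c + e) ≈ (a * d + b * c) + (a * f + b * e)
    distrib-im a b c d e f = ≗⇒≈ λ n → solve 6 (λ a b c d e f →
      a :* (d :+ f) :+ b :* (c :+ e) := (a :* d :+ b :* c) :+ (a :* f :+ b :* e)) refl (seq a n) (seq b n) (seq c n) (seq d n) (seq e n) (seq f n)

    comm-re : ∀ a b c d → a * c - b * d ≈ c * a - d * b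
    comm-re a b c d = ≗⇒≈ λ n → solve 4 (λ a b c d →
      a :* c :- b :* d := c :* a :- d :* b) refl (seq a n) (seq b n) (seq c n) (seq d n)

    comm-im : ∀ a b c d → a * d + b * c ≈ c * b + d * a
    comm-im a b c d = ≗⇒≈ λ n → solve 4 (λ a b c d →
      a :* d :+ b :* c := c :* b :+ d :* a) refl (seq a n) (seq b n) (seq c n) (seq d n)

    identity-re : ∀ a b → 1ℝ * a - 0ℝ * b ≈ a
    identity-re a b = ≗⇒≈ λ n → solve 2 (λ a b →
      con 1ℚ :* a :- con 0ℚ :* b := a) refl (seq a n) (seq b n)

    identity-im : ∀ a b → 1ℝ * b + 0ℝ * a ≈ b
    identity-im a b = ≗⇒≈ λ n → solve 2 (λ a b →
      con 1ℚ :* b :+ con 0ℚ :* a := b) refl (seq a n) (seq b n)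

    inverse-re : ∀ a b m → a * m * a - - (b * m) * b ≈ (a * a + b * b) * m
    inverse-re a b m = ≗⇒≈ λ n → solve 3 (λ a b m →
      a :* m :* a :- :- (b :* m) :* b := (a :* a :+ b :* b) :* m) refl (seq a n) (seq b n) (seq m n)

    inverse-im : ∀ a b m → a * m * b + - (b * m) * a ≈ 0ℝ
    inverse-im a b m = ≗⇒≈ λ n → solve 3 (λ a b m →
      a :* m :* b :+ :- (b :* m) :* a := con 0ℚ) refl (seq a n) (seq b n) (seq m n)

module Complex where
  open Real using (ℝ; x²+y²#0)
  private
    module R where
      open HeytingField Real.heytingField public
      open HeytingProperties Real.heytingField public
    module Id = GaussianIdentities

  infix  4 _≈_ _#_
  infixl 6 _+_ _-_
  infixl 7 _*_
  infix  8 -_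

  record ℂ : Set where
    no-eta-equality
    field
      re im : ℝ
  open ℂ public

  record _≈_ (z w : ℂ) : Set where
    constructor _,_
    field
      re-≈ : re z R.≈ re w
      im-≈ : im z R.≈ im w
  open _≈_ public

  _#_ : ℂ → ℂ → Set
  z # w = (re z R.# re w) ⊎ (im z R.# im w)

  fromℝ : ℝ → ℂ
  fromℝ x .re = x
  fromℝ x .im = R.0#

  0ℂ 1ℂ : ℂ
  0ℂ = fromℝ R.0#
  1ℂ = fromℝ R.1#

  _+_ : ℂ → ℂ → ℂ
  (z + w) .re = re z R.+ re w
  (z + w) .im = im z R.+ im w

  -_ : ℂ → ℂ
  (- z) .re = R.- re z
  (- z) .im = R.- im z

  _-_ : ℂ → ℂ → ℂ
  z - w = z + - w

  _*_ : ℂ → ℂ → ℂ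
  (z * w) .re = re z R.* re w R.- im z R.* im w
  (z * w) .im = re z R.* im w R.+ im z R.* re w

  private
    ≈-isEquivalence : IsEquivalence _≈_
    ≈-isEquivalence = record
      { refl = R.refl , R.refl
      ; sym = λ (p , q) → R.sym p , R.sym q
      ; trans = λ (p , q) (p′ , q′) → R.trans p p′ , R.trans q q′ }

    setoid : Setoid 0ℓ 0ℓ
    setoid = record { isEquivalence = ≈-isEquivalence }

    open import Algebra.Consequences.Setoid setoid
      using (comm∧idˡ⇒id; comm∧invˡ⇒inv; comm∧distrˡ⇒distr)

    +-cong : ∀ {x y u v} → x ≈ y → u ≈ v → x + u ≈ y + v
    +-cong (p , q) (p′ , q′) = R.+-cong p p′ , R.+-cong q q′

    *-cong : ∀ {x y u v} → x ≈ y → u ≈ v → x * u ≈ y * v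
    *-cong (p , q) (p′ , q′) =
      R.+-cong (R.*-cong p p′) (R.-‿cong (R.*-cong q q′)) , R.+-cong (R.*-cong p q′) (R.*-cong q p′)

    +-comm : ∀ z w → z + w ≈ w + z
    +-comm z w = R.+-comm (re z) (re w) , R.+-comm (im z) (im w)

    *-comm : ∀ z w → z * w ≈ w * z
    *-comm z w = Id.comm-re (re z) (im z) (re w) (im w) , Id.comm-im (re z) (im z) (re w) (im w)

    *-assoc : ∀ z w u → (z * w) * u ≈ z * (w * u)
    *-assoc z w u = Id.assoc-re (re z) (im z) (re w) (im w) (re u) (im u)
                  , Id.assoc-im (re z) (im z) (re w) (im w) (re u) (im u)

    *-distribˡ-+ : ∀ z w u → z * (w + u) ≈ z * w + z * u
    *-distribˡ-+ z w u = Id.distrib-re (re z) (im z) (re w) (im w) (re u) (im u)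
                       , Id.distrib-im (re z) (im z) (re w) (im w) (re u) (im u)

  commutativeRing : CommutativeRing 0ℓ 0ℓ
  commutativeRing = record
    { Carrier = ℂ ; _≈_ = _≈_ ; _+_ = _+_ ; _*_ = _*_ ; -_ = -_ ; 0# = 0ℂ ; 1# = 1ℂ
    ; isCommutativeRing = record
      { isRing = record
        { +-isAbelianGroup = record
          { isGroup = record
            { isMonoid = record
              { isSemigroup = record
                { isMagma = record { isEquivalence = ≈-isEquivalence ; ∙-cong = +-cong }
                ; assoc = λ z w u → R.+-assoc (re z) (re w) (re u) , R.+-assoc (im z) (im w) (im u) }
              ; identity = comm∧idˡ⇒id +-comm λ z → R.+-identityˡ (re z) , R.+-identityˡ (im z) }
            ; inverse = comm∧invˡ⇒inv +-comm λ z → R.-‿inverseˡ (re z) , R.-‿inverseˡ (im z)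
            ; ⁻¹-cong = λ (p , q) → R.-‿cong p , R.-‿cong q }
          ; comm = +-comm }
        ; *-cong = *-cong
        ; *-assoc = *-assoc
        ; *-identity = comm∧idˡ⇒id *-comm λ z → Id.identity-re (re z) (im z) , Id.identity-im (re z) (im z)
        ; distrib = comm∧distrˡ⇒distr +-cong *-comm *-distribˡ-+ }
      ; *-comm = *-comm } }

  #-irrefl : ∀ {z w} → z ≈ w → ¬ z # w
  #-irrefl (p , q) (inj₁ a) = R.#-irrefl p a
  #-irrefl (p , q) (inj₂ a) = R.#-irrefl q a

  #-sym : ∀ {z w} → z # w → w # z
  #-sym = Sum.map R.#-sym R.#-sym

  #-cotrans : ∀ {z w} → z # w → ∀ u → (z # u) ⊎ (u # w)
  #-cotrans (inj₁ a) u = Sum.map inj₁ inj₁ (R.#-cotrans a (re u))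
  #-cotrans (inj₂ a) u = Sum.map inj₂ inj₂ (R.#-cotrans a (im u))

  ¬#⇒≈ : ∀ {z w} → ¬ z # w → z ≈ w
  ¬#⇒≈ {z} {w} n = proj₁ (HeytingField.tight Real.heytingField (re z) (re w)) (λ a → n (inj₁ a))
                 , proj₁ (HeytingField.tight Real.heytingField (im z) (im w)) (λ a → n (inj₂ a))

  private
    open CommutativeRing commutativeRing using () renaming (trans to ≈-trans)

    norm² : ℂ → ℝ
    norm² u = re u R.* re u R.+ im u R.* im u

    conj* : ℂ → ℝ → ℂ
    conj* u m .re = re u R.* m
    conj* u m .im = R.- (im u R.* m)

    conj*-inverse : ∀ u m → norm² u R.* m R.≈ R.1# → conj* u m * u ≈ 1ℂ
    conj*-inverse u m eq =
      R.trans (Id.inverse-re (re u) (im u) m) eq , Id.inverse-im (re u) (im u) m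

    x#0⇒invertible : ∀ {x} → x R.# R.0# → ∃[ m ] x R.* m R.≈ R.1#
    x#0⇒invertible {x} x#0 =
      let m , _ , xm≈1 = R.#⇒invertible x#0
      in m , R.trans (R.*-congʳ (R.sym (R.x-0≈x x))) xm≈1

  #⇒invertible : ∀ {z w} → z # w → ∃[ u ] ((u * (z - w) ≈ 1ℂ) × ((z - w) * u ≈ 1ℂ))
  #⇒invertible {z} {w} z#w = u , left , ≈-trans (*-comm (z - w) u) left
    where
    part#0 : (re (z - w) R.# R.0#) ⊎ (im (z - w) R.# R.0#)
    part#0 = Sum.map (R.x#y⇒x-y#0 {re z} {re w}) (R.x#y⇒x-y#0 {im z} {im w}) z#w
    inverse : ∃[ m ] norm² (z - w) R.* m R.≈ R.1#
    inverse = x#0⇒invertible (x²+y²#0 part#0)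
    u = conj* (z - w) (proj₁ inverse)
    left : u * (z - w) ≈ 1ℂ
    left = conj*-inverse (z - w) (proj₁ inverse) (proj₂ inverse)

  invertible⇒# : ∀ {z w} → ∃[ u ] ((u * (z - w) ≈ 1ℂ) × ((z - w) * u ≈ 1ℂ)) → z # w
  invertible⇒# {z} {w} (u , (p , _) , _) = Sum.map fromRe fromIm (R.#-cotrans products-apart R.0#)
    where
    a b c d : ℝ
    a = re u
    b = im u
    c = re z R.- re w
    d = im z R.- im w
    products-apart : a R.* c R.# b R.* d
    products-apart = R.x-y#0⇒x#y (R.#-congʳ (R.sym p) R.1#0)
    fromRe : a R.* c R.# R.0# → re z R.# re w
    fromRe l = R.x-y#0⇒x#y (R.factorʳ#0 {a} {c} l)
    fromIm : R.0# R.# b R.* d → im z R.# im w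
    fromIm l = R.x-y#0⇒x#y (R.factorʳ#0 {b} {d} (R.#-sym l))

  heytingField : HeytingField 0ℓ 0ℓ 0ℓ
  heytingField = record
    { Carrier = ℂ ; _≈_ = _≈_ ; _#_ = _#_ ; _+_ = _+_ ; _*_ = _*_ ; -_ = -_ ; 0# = 0ℂ ; 1# = 1ℂ
    ; isHeytingField = record
      { isHeytingCommutativeRing = record
        { isCommutativeRing = CommutativeRing.isCommutativeRing commutativeRing
        ; isApartnessRelation = record
          { irrefl = λ {z} {w} → #-irrefl {z} {w}
          ; sym = λ {z} {w} → #-sym {z} {w}
          ; cotrans = λ {z} {w} → #-cotrans {z} {w} }
        ; #⇒invertible = λ {z} {w} → #⇒invertible {z} {w}
        ; invertible⇒# = λ {z} {w} → invertible⇒# {z} {w} }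
      ; tight = λ _ _ → ¬#⇒≈ , #-irrefl } }

module QCalculus {c ℓ₁ ℓ₂} (F : HeytingField c ℓ₁ ℓ₂) where
  open import Data.Nat.Base using (_≤_)
  open import Data.Nat.Properties using (m∸n≤m)
  open import Relation.Binary.PropositionalEquality using (subst)
  open HeytingField F using (Carrier; _#_; _+_; _*_; _-_; 0#; 1#; #⇒invertible)
  open HeytingProperties F
  open CommutativeRing (HeytingCommutativeRing.commutativeRing (HeytingField.heytingCommutativeRing F))
    using (semiring; +-monoid)
  open Semiring semiring using (rawSemiring)
  open import Algebra.Definitions.RawSemiring rawSemiring public using (_^_)
  open import Algebra.Definitions.RawSemiring rawSemiring using (product)
  open import Algebra.Properties.Monoid.Sum +-monoid public using (sum; sum⁺-syntax)

  infixl 7 _/_⟨_⟩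

  -- #⇒invertible y#0 inverts y - 0#, which is ≈ y.
  _/_⟨_⟩ : ∀ x y → y # 0# → Carrier
  x / y ⟨ y#0 ⟩ = x * proj₁ (#⇒invertible y#0)

  product-#0 : ∀ {n} (f : Fin n → Carrier) → (∀ i → f i # 0#) → product f # 0#
  product-#0 {zero}  f nz = 1#0
  product-#0 {suc n} f nz = x#0y#0→xy#0 (nz zero) (product-#0 (λ i → f (suc i)) (λ i → nz (suc i)))

  factor-#0 : ∀ {n} (f : Fin n → Carrier) → product f # 0# → ∀ i → f i # 0#
  factor-#0 f nz zero    = factorˡ#0 nz
  factor-#0 f nz (suc i) = factor-#0 (λ i → f (suc i)) (factorʳ#0 nz) i

  ^-#0 : ∀ {x} n → x # 0# → x ^ n # 0#
  ^-#0 zero    x#0 = 1#0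
  ^-#0 (suc n) x#0 = x#0y#0→xy#0 x#0 (^-#0 n x#0)

  -- (q ; q)ₘ; the factors run from 1 - q¹ to 1 - qᵐ.
  qPochhammer : Carrier → ℕ → Carrier
  qPochhammer q m = product {m} (λ j → 1# - q ^ suc (toℕ j))

  qPochhammer-#0 : ∀ q {m n} → m ≤ n → qPochhammer q n # 0# → qPochhammer q m # 0#
  qPochhammer-#0 q m≤n nz = product-#0 _ λ j →
    subst (λ i → 1# - q ^ suc i # 0#) (toℕ-inject≤ j m≤n) (factor-#0 _ nz (inject≤ j m≤n))

  qBinomial : ∀ q n k → k ≤ n → qPochhammer q n # 0# → Carrier
  qBinomial q n k k≤n nz =
    qPochhammer q n / (qPochhammer q k * qPochhammer q (n ∸ k))
      ⟨ x#0y#0→xy#0 (qPochhammer-#0 q k≤n nz) (qPochhammer-#0 q (m∸n≤m n k) nz) ⟩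

  -- (x - a)_q^k, which depends on a / x rather than on the difference x - a
  shiftedPower : ∀ x a q → x # 0# → q # 0# → ℕ → Carrier
  shiftedPower x a q x#0 q#0 k = product {k} λ j →
    1# - a / (q ^ toℕ j * x) ⟨ x#0y#0→xy#0 (^-#0 (toℕ j) q#0) x#0 ⟩

open Complex public using (ℂ; _≈_; _#_; _*_; -_; 0ℂ; 1ℂ)
open QCalculus Complex.heytingField public

{-# OPTIONS --safe #-}

-- With t = a / x and uₖ = (-1)ᵏ λ^(k choose 2) (x - a)_λᵏ, the telescoping
-- identity λᵏ uₖ + uₖ₊₁ = t uₖ holds.  By the Pascal rule, replacing n by n + 1
-- in ∑ₖ [n k] uₖ has the effect of replacing uₖ by λᵏ uₖ + uₖ₊₁, that is, of
-- multiplying the sum by t.  Hence the sum equals tⁿ u₀ = (a / x)ⁿ.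

module Submission where

open import Algebra.Apartness.Bundles using (HeytingCommutativeRing; HeytingField)
open import Algebra.Bundles using (CommutativeRing; Monoid)
open import Data.Fin.Base using (toℕ)
open import Data.Fin.Properties using (toℕ≤pred[n]; toℕ-inject₁; toℕ-fromℕ)
open import Data.Nat.Base as ℕ using (ℕ; zero; suc; _<_; _≤_; _∸_; s≤s)
open import Data.Nat.Combinatorics using (_C_; nC1≡n; nCk+nC[k+1]≡[n+1]C[k+1])
import Data.Nat.Properties as ℕₚ
open import Data.Product.Base using (proj₁; proj₂)
open import Relation.Binary.PropositionalEquality as ≡ using (_≡_)
import Defs

module _ {c ℓ} (M : Monoid c ℓ) where
  open Monoid M
  open import Algebra.Properties.Monoid.Sum M

  -- Finite sums unfold at index 0, while the recursions below need the top index split off. Stated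
  -- for a monoid so that it serves products as well as sums.
  sum-last : ∀ n (f : ℕ → Carrier) → ∑[ i ≤ n ] f (toℕ i) ≈ ∑[ i < n ] f (toℕ i) ∙ f n
  sum-last n f = trans (sum-init-last {n} (λ i → f (toℕ i)))
    (reflexive (≡.cong₂ _∙_ (sum-cong-≗ {n} (λ i → ≡.cong f (toℕ-inject₁ i))) (≡.cong f (toℕ-fromℕ n))))

module QBinomialInversion {c ℓ₁ ℓ₂} (F : HeytingField c ℓ₁ ℓ₂) where
  open HeytingField F using (_#_; #⇒invertible)
  open CommutativeRing (HeytingCommutativeRing.commutativeRing (HeytingField.heytingCommutativeRing F))
    hiding (zero)
  open Defs.HeytingProperties F using (x-0≈x; x#0y#0→xy#0)
  open Defs.QCalculus F
  open import Algebra.Properties.CommutativeSemiring.Exp commutativeSemiring using (^-congˡ; ^-distrib-*; ^-homo-*)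
  open import Algebra.Properties.Ring ring using (-‿distribˡ-*; -‿distribʳ-*; -1*x≈-x; -‿involutive)
  open import Algebra.Properties.Semiring.Sum semiring using (sum-cong-≋; ∑-distrib-+; *-distribˡ-sum)
  open import Algebra.Solver.Ring.NaturalCoefficients.Default commutativeSemiring
    using (solve; _:=_; _:+_; _:*_; con)
  open import Relation.Binary.Reasoning.Setoid setoid

  -- Quotients and ring identities.

  y*1/y≈1 : ∀ {y} (y#0 : y # 0#) → y * proj₁ (#⇒invertible y#0) ≈ 1#
  y*1/y≈1 {y} y#0 = trans (*-congʳ (sym (x-0≈x y))) (proj₂ (proj₂ (#⇒invertible y#0)))

  -- Reduces an equation for a quotient to one with the denominator cleared, whichever proof of
  -- apartness the quotient carries.
  /-unique : ∀ {x y z} (y#0 : y # 0#) → z * y ≈ x → x / y ⟨ y#0 ⟩ ≈ z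
  /-unique {x} {y} {z} y#0 zy≈x = begin
    x * y⁻¹        ≈⟨ *-congʳ zy≈x ⟨
    z * y * y⁻¹    ≈⟨ *-assoc z y y⁻¹ ⟩
    z * (y * y⁻¹)  ≈⟨ *-congˡ (y*1/y≈1 y#0) ⟩
    z * 1#         ≈⟨ *-identityʳ z ⟩
    z              ∎
    where y⁻¹ = proj₁ (#⇒invertible y#0)

  x/y*y≈x : ∀ {x y} (y#0 : y # 0#) → x / y ⟨ y#0 ⟩ * y ≈ x
  x/y*y≈x {x} {y} y#0 = begin
    x * y⁻¹ * y    ≈⟨ solve 3 (λ x y z → x :* z :* y := x :* (y :* z)) refl x y y⁻¹ ⟩
    x * (y * y⁻¹)  ≈⟨ *-congˡ (y*1/y≈1 y#0) ⟩
    x * 1#         ≈⟨ *-identityʳ x ⟩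
    x              ∎
    where y⁻¹ = proj₁ (#⇒invertible y#0)

  -- Serves to cancel `q ^ k` against the denominator of the k-th factor of the shifted power.
  z*[x/zy]≈x/y : ∀ {x y z} (y#0 : y # 0#) (zy#0 : z * y # 0#) →
                 z * x / (z * y) ⟨ zy#0 ⟩ ≈ x / y ⟨ y#0 ⟩
  z*[x/zy]≈x/y {x} {y} {z} y#0 zy#0 = /-unique zy#0 (begin
    x / y ⟨ y#0 ⟩ * (z * y)    ≈⟨ solve 3 (λ w y z → w :* (z :* y) := z :* (w :* y)) refl (x / y ⟨ y#0 ⟩) y z ⟩
    z * (x / y ⟨ y#0 ⟩ * y)    ≈⟨ *-congˡ (x/y*y≈x y#0) ⟩
    z * x                      ∎)

  -x*-y≈x*y : ∀ x y → - x * - y ≈ x * y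
  -x*-y≈x*y x y = begin
    - x * - y      ≈⟨ -‿distribˡ-* x (- y) ⟨
    - (x * - y)    ≈⟨ -‿cong (-‿distribʳ-* x y) ⟨
    - (- (x * y))  ≈⟨ -‿involutive (x * y) ⟩
    x * y          ∎

  x-x[1-y]≈xy : ∀ x y → x + - x * (1# - y) ≈ x * y
  x-x[1-y]≈xy x y = begin
    x + - x * (1# - y)          ≈⟨ +-congˡ (distribˡ (- x) 1# (- y)) ⟩
    x + (- x * 1# + - x * - y)  ≈⟨ +-congˡ (+-cong (*-identityʳ (- x)) (-x*-y≈x*y x y)) ⟩
    x + (- x + x * y)           ≈⟨ +-assoc x (- x) (x * y) ⟨
    x - x + x * y               ≈⟨ +-congʳ (-‿inverseʳ x) ⟩
    0# + x * y                  ≈⟨ +-identityˡ (x * y) ⟩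
    x * y                       ∎

  -- With powers of `q` for `x` and `y`, this is what makes the Pascal rule agree with the
  -- q-Pochhammer quotient.
  x[1-y]+[1-x]≈1-xy : ∀ x y → x * (1# - y) + (1# - x) ≈ 1# - x * y
  x[1-y]+[1-x]≈1-xy x y = begin
    x * (1# - y) + (1# - x)        ≈⟨ +-congʳ (distribˡ x 1# (- y)) ⟩
    x * 1# + x * - y + (1# - x)    ≈⟨ solve 3 (λ x y z → x :* con 1 :+ y :+ (con 1 :+ z) := con 1 :+ y :+ (x :+ z)) refl x (x * - y) (- x) ⟩
    1# + x * - y + (x - x)         ≈⟨ +-cong (+-congˡ (sym (-‿distribʳ-* x y))) (-‿inverseʳ x) ⟩
    1# - x * y + 0#                ≈⟨ +-identityʳ (1# - x * y) ⟩
    1# - x * y                     ∎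

  -- Gaussian binomials from the q-Pascal rule.

  module _ (q : Carrier) where

    -- The Gaussian binomial in division-free form: it is defined for every `q` and also for k > n,
    -- so sums can be re-indexed without side conditions.
    pascal : ℕ → ℕ → Carrier
    pascal n       zero    = 1#
    pascal zero    (suc k) = 0#
    pascal (suc n) (suc k) = q ^ suc k * pascal n (suc k) + pascal n k

    pascal-zero : ∀ {n k} → n < k → pascal n k ≈ 0#
    pascal-zero {zero}  {suc k} _ = refl
    pascal-zero {suc n} {suc k} (s≤s n<k) = begin
      q ^ suc k * pascal n (suc k) + pascal n k  ≈⟨ +-cong (*-congˡ (pascal-zero (ℕₚ.m<n⇒m<1+n n<k))) (pascal-zero n<k) ⟩
      q ^ suc k * 0# + 0#                        ≈⟨ +-identityʳ (q ^ suc k * 0#) ⟩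
      q ^ suc k * 0#                             ≈⟨ zeroʳ (q ^ suc k) ⟩
      0#                                         ∎

    qPochhammer-suc : ∀ m → qPochhammer q (suc m) ≈ qPochhammer q m * (1# - q ^ suc m)
    qPochhammer-suc m = sum-last *-monoid m (λ j → 1# - q ^ suc j)

    -- Writing the upper index as k + m avoids truncated subtraction. Double induction: the two
    -- terms of the Pascal rule correspond to lowering m and to lowering k.
    pascal-qPochhammer : ∀ k m →
      pascal (k ℕ.+ m) k * (qPochhammer q k * qPochhammer q m) ≈ qPochhammer q (k ℕ.+ m)
    pascal-qPochhammer zero m = trans (*-identityˡ _) (*-identityˡ _)
    pascal-qPochhammer (suc k) zero = begin
      (q ^ suc k * pascal (k ℕ.+ 0) (suc k) + g) * (Q (suc k) * 1#)
        -- On the diagonal the first Pascal term lies outside the triangle and vanishes.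
        ≈⟨ *-cong (+-congʳ (*-congˡ (pascal-zero k+0<1+k))) (*-congʳ (qPochhammer-suc k)) ⟩
      (q ^ suc k * 0# + g) * (Q k * r * 1#)
        ≈⟨ solve 4 (λ p g Q r → (p :* con 0 :+ g) :* (Q :* r :* con 1) := g :* (Q :* con 1) :* r) refl (q ^ suc k) g (Q k) r ⟩
      g * (Q k * 1#) * r
        ≈⟨ *-congʳ (pascal-qPochhammer k 0) ⟩
      Q (k ℕ.+ 0) * r
        ≡⟨ ≡.cong (λ i → Q (k ℕ.+ 0) * (1# - q ^ suc i)) (ℕₚ.+-identityʳ k) ⟨
      Q (k ℕ.+ 0) * (1# - q ^ suc (k ℕ.+ 0))
        ≈⟨ qPochhammer-suc (k ℕ.+ 0) ⟨
      Q (suc (k ℕ.+ 0))  ∎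
      where
      Q = qPochhammer q
      g = pascal (k ℕ.+ 0) k
      r = 1# - q ^ suc k
      k+0<1+k : k ℕ.+ 0 < suc k
      k+0<1+k = s≤s (ℕₚ.≤-reflexive (ℕₚ.+-identityʳ k))
    pascal-qPochhammer (suc k) (suc m) = begin
      (p * g₁ + g₀) * (Q (suc k) * Q (suc m))
        ≈⟨ solve 5 (λ p g₁ g₀ Qk Qm → (p :* g₁ :+ g₀) :* (Qk :* Qm)
             := p :* (g₁ :* (Qk :* Qm)) :+ g₀ :* (Qk :* Qm)) refl p g₁ g₀ (Q (suc k)) (Q (suc m)) ⟩
      p * (g₁ * (Q (suc k) * Q (suc m))) + g₀ * (Q (suc k) * Q (suc m))
        ≈⟨ +-cong (*-congˡ (*-congˡ (*-congˡ (qPochhammer-suc m)))) (*-congˡ (*-congʳ (qPochhammer-suc k))) ⟩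
      p * (g₁ * (Q (suc k) * (Q m * (1# - p′)))) + g₀ * (Q k * (1# - p) * Q (suc m))
        ≈⟨ solve 9 (λ p g₁ g₀ Qk′ Qm s Qk r Qm′ →
             p :* (g₁ :* (Qk′ :* (Qm :* s))) :+ g₀ :* (Qk :* r :* Qm′)
             := p :* (g₁ :* (Qk′ :* Qm) :* s) :+ g₀ :* (Qk :* Qm′) :* r)
             refl p g₁ g₀ (Q (suc k)) (Q m) (1# - p′) (Q k) (1# - p) (Q (suc m)) ⟩
      p * (g₁ * (Q (suc k) * Q m) * (1# - p′)) + g₀ * (Q k * Q (suc m)) * (1# - p)
        ≈⟨ +-cong (*-congˡ (*-congʳ ih₁)) (*-congʳ (pascal-qPochhammer k (suc m))) ⟩
      p * (Q (k ℕ.+ suc m) * (1# - p′)) + Q (k ℕ.+ suc m) * (1# - p)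
        ≈⟨ solve 4 (λ p Q s r → p :* (Q :* s) :+ Q :* r := Q :* (p :* s :+ r)) refl p (Q (k ℕ.+ suc m)) (1# - p′) (1# - p) ⟩
      Q (k ℕ.+ suc m) * (p * (1# - p′) + (1# - p))
        -- With the common Pochhammer symbol factored out, the bracket collapses to the one new
        -- factor of the next symbol.
        ≈⟨ *-congˡ (x[1-y]+[1-x]≈1-xy p p′) ⟩
      Q (k ℕ.+ suc m) * (1# - p * p′)
        ≈⟨ *-congˡ (+-congˡ (-‿cong (^-homo-* q (suc k) (suc m)))) ⟨
      Q (k ℕ.+ suc m) * (1# - q ^ suc (k ℕ.+ suc m))
        ≈⟨ qPochhammer-suc (k ℕ.+ suc m) ⟨
      Q (suc (k ℕ.+ suc m))  ∎
      where
      Q = qPochhammer q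
      p = q ^ suc k
      p′ = q ^ suc m
      g₁ = pascal (k ℕ.+ suc m) (suc k)
      g₀ = pascal (k ℕ.+ suc m) k
      ih₁ : g₁ * (Q (suc k) * Q m) ≈ Q (k ℕ.+ suc m)
      -- The hypothesis has upper index `suc k + m`, which must be moved to `k + suc m` to match the
      -- other term.
      ih₁ = ≡.subst (λ i → pascal i (suc k) * (Q (suc k) * Q m) ≈ Q i) (≡.sym (ℕₚ.+-suc k m))
              (pascal-qPochhammer (suc k) m)

    qBinomial≈pascal : ∀ {n k} (k≤n : k ≤ n) (nz : qPochhammer q n # 0#) →
                       qBinomial q n k k≤n nz ≈ pascal n k
    qBinomial≈pascal {n} {k} k≤n nz = /-unique _
      (≡.subst (λ i → pascal i k * (qPochhammer q k * qPochhammer q (n ∸ k)) ≈ qPochhammer q i)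
        (ℕₚ.m+[n∸m]≡n k≤n) (pascal-qPochhammer k (n ∸ k)))

    -- Sums weighted by Gaussian binomials.

    -- The Pascal rule splits the sum in two; shifting the index in one half moves the recursion
    -- from the coefficients to the sequence `u`.
    pascal-sum-suc : ∀ n (u : ℕ → Carrier) →
      ∑[ k ≤ suc n ] (pascal (suc n) (toℕ k) * u (toℕ k))
        ≈ ∑[ k ≤ n ] (pascal n (toℕ k) * (q ^ toℕ k * u (toℕ k) + u (suc (toℕ k))))
    pascal-sum-suc n u = begin
      1# * u 0 + ∑[ k ≤ n ] (pascal (suc n) (suc (toℕ k)) * u (suc (toℕ k)))
        -- The leading term becomes `T 0` because `q ^ 0` is `1#`, so it can join the shifted sum.
        ≈⟨ +-cong (*-congˡ (sym (*-identityˡ (u 0)))) (sum-cong-≋ {suc n} λ k →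
             solve 4 (λ p g h v → (p :* g :+ h) :* v := g :* (p :* v) :+ h :* v) refl
               (q ^ suc (toℕ k)) (pascal n (suc (toℕ k))) (pascal n (toℕ k)) (u (suc (toℕ k)))) ⟩
      T 0 + ∑[ k ≤ n ] (T (suc (toℕ k)) + B (toℕ k))
        ≈⟨ +-congˡ (∑-distrib-+ {suc n} (λ k → T (suc (toℕ k))) (λ k → B (toℕ k))) ⟩
      T 0 + (∑[ k ≤ n ] T (suc (toℕ k)) + ∑B)
        ≈⟨ +-assoc (T 0) _ ∑B ⟨
      ∑[ k ≤ suc n ] T (toℕ k) + ∑B
        ≈⟨ +-congʳ (sum-last +-monoid (suc n) T) ⟩
      ∑T + T (suc n) + ∑B
        -- The extra top term has lower index n + 1 over upper index n, hence is zero.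
        ≈⟨ +-congʳ (+-congˡ (trans (*-congʳ (pascal-zero (ℕₚ.n<1+n n))) (zeroˡ _))) ⟩
      ∑T + 0# + ∑B
        ≈⟨ +-congʳ (+-identityʳ ∑T) ⟩
      ∑T + ∑B
        ≈⟨ ∑-distrib-+ {suc n} (λ k → T (toℕ k)) (λ k → B (toℕ k)) ⟨
      ∑[ k ≤ n ] (T (toℕ k) + B (toℕ k))
        ≈⟨ sum-cong-≋ {suc n} (λ k → distribˡ (pascal n (toℕ k)) (q ^ toℕ k * u (toℕ k)) (u (suc (toℕ k)))) ⟨
      ∑[ k ≤ n ] (pascal n (toℕ k) * (q ^ toℕ k * u (toℕ k) + u (suc (toℕ k))))  ∎
      where
      T B : ℕ → Carrier
      T k = pascal n k * (q ^ k * u k)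
      B k = pascal n k * u (suc k)
      ∑T = ∑[ k ≤ n ] T (toℕ k)
      ∑B = ∑[ k ≤ n ] B (toℕ k)

    -- The hypothesis says that `u` is an eigenvector, with eigenvalue `t`, of the operator that
    -- raising n applies to the sequence; each step thus contributes one factor `t`.
    pascal-sum : ∀ {t} {u : ℕ → Carrier} → (∀ k → q ^ k * u k + u (suc k) ≈ t * u k) →
                 ∀ n → ∑[ k ≤ n ] (pascal n (toℕ k) * u (toℕ k)) ≈ t ^ n * u 0
    pascal-sum {t} {u} step zero    = +-identityʳ (1# * u 0)
    pascal-sum {t} {u} step (suc n) = begin
      ∑[ k ≤ suc n ] (pascal (suc n) (toℕ k) * u (toℕ k))
        ≈⟨ pascal-sum-suc n u ⟩
      ∑[ k ≤ n ] (pascal n (toℕ k) * (q ^ toℕ k * u (toℕ k) + u (suc (toℕ k))))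
        ≈⟨ sum-cong-≋ {suc n} (λ k → trans (*-congˡ (step (toℕ k)))
             (solve 3 (λ g t v → g :* (t :* v) := t :* (g :* v)) refl (pascal n (toℕ k)) t (u (toℕ k)))) ⟩
      ∑[ k ≤ n ] (t * (pascal n (toℕ k) * u (toℕ k)))
        ≈⟨ *-distribˡ-sum {suc n} t (λ k → pascal n (toℕ k) * u (toℕ k)) ⟨
      t * (∑[ k ≤ n ] (pascal n (toℕ k) * u (toℕ k)))
        ≈⟨ *-congˡ (pascal-sum step n) ⟩
      t * (t ^ n * u 0)
        ≈⟨ *-assoc t (t ^ n) (u 0) ⟨
      t ^ suc n * u 0  ∎

    -- Signed weights and the telescoping identity.

    signedWeight : ℕ → Carrier
    signedWeight k = (- 1#) ^ k * q ^ (k C 2)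

    signedWeight-suc : ∀ k → signedWeight (suc k) ≈ - (q ^ k * signedWeight k)
    signedWeight-suc k = begin
      - 1# * s * q ^ (suc k C 2)       ≡⟨ ≡.cong (λ i → - 1# * s * q ^ i) [1+k]C2 ⟨
      - 1# * s * q ^ (k ℕ.+ k C 2)     ≈⟨ *-congˡ (^-homo-* q k (k C 2)) ⟩
      - 1# * s * (q ^ k * q ^ (k C 2)) ≈⟨ solve 4 (λ m s p r → m :* s :* (p :* r) := m :* (p :* (s :* r))) refl (- 1#) s (q ^ k) (q ^ (k C 2)) ⟩
      - 1# * (q ^ k * signedWeight k)  ≈⟨ -1*x≈-x _ ⟩
      - (q ^ k * signedWeight k)       ∎
      where
      s = (- 1#) ^ k
      [1+k]C2 : k ℕ.+ k C 2 ≡ suc k C 2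
      -- The ordinary Pascal rule at lower index 1, with k choose 1 rewritten as k.
      [1+k]C2 = ≡.trans (≡.cong (ℕ._+ k C 2) (≡.sym (nC1≡n k))) (nCk+nC[k+1]≡[n+1]C[k+1] k 1)

    module _ {a x : Carrier} (x#0 : x # 0#) (q#0 : q # 0#) where

      private
        t = a / x ⟨ x#0 ⟩
        P = shiftedPower x a q x#0 q#0
        u : ℕ → Carrier
        u k = signedWeight k * P k

      -- Passing to k + 1 multiplies `u k` by `- q ^ k` and by `1# - r k`. The added `q ^ k * u k`
      -- cancels the contribution of the 1, leaving `q ^ k * r k * u k`.
      signedShiftedPower-step : ∀ k → q ^ k * u k + u (suc k) ≈ t * u k
      signedShiftedPower-step k = begin
        q ^ k * (w * P k) + signedWeight (suc k) * P (suc k)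
          ≈⟨ +-congˡ (*-cong (signedWeight-suc k) (sum-last *-monoid k (λ j → 1# - r j))) ⟩
        q ^ k * (w * P k) + - (q ^ k * w) * (P k * (1# - r k))
          ≈⟨ +-cong (sym (*-assoc (q ^ k) w (P k))) (trans (sym (*-assoc _ (P k) _)) (*-congʳ (sym (-‿distribˡ-* (q ^ k * w) (P k))))) ⟩
        q ^ k * w * P k + - (q ^ k * w * P k) * (1# - r k)
          ≈⟨ x-x[1-y]≈xy (q ^ k * w * P k) (r k) ⟩
        q ^ k * w * P k * r k
          ≈⟨ solve 5 (λ p w P a i → p :* w :* P :* (a :* i) := p :* a :* i :* (w :* P)) refl (q ^ k) w (P k) a (proj₁ (#⇒invertible (qx#0 k))) ⟩
        q ^ k * a / (q ^ k * x) ⟨ qx#0 k ⟩ * (w * P k)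
          -- The power of `q` cancels, so the multiplier no longer depends on k.
          ≈⟨ *-congʳ (z*[x/zy]≈x/y x#0 (qx#0 k)) ⟩
        t * u k  ∎
        where
        w = signedWeight k
        qx#0 : ∀ j → q ^ j * x # 0#
        qx#0 j = x#0y#0→xy#0 (^-#0 j q#0) x#0
        r : ℕ → Carrier
        r j = a / (q ^ j * x) ⟨ qx#0 j ⟩

      shiftedPower-sum : ∀ n (nz : qPochhammer q n # 0#) →
        ∑[ k ≤ n ] ((- 1#) ^ toℕ k * q ^ (toℕ k C 2)
                     * qBinomial q n (toℕ k) (toℕ≤pred[n] k) nz * P (toℕ k))
          ≈ t ^ n
      shiftedPower-sum n nz = begin
        ∑[ k ≤ n ] (signedWeight (toℕ k) * qBinomial q n (toℕ k) (toℕ≤pred[n] k) nz * P (toℕ k))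
          ≈⟨ sum-cong-≋ {suc n} (λ k → trans (*-congʳ (*-congˡ (qBinomial≈pascal (toℕ≤pred[n] k) nz)))
               (solve 3 (λ w g P → w :* g :* P := g :* (w :* P)) refl (signedWeight (toℕ k)) (pascal n (toℕ k)) (P (toℕ k)))) ⟩
        ∑[ k ≤ n ] (pascal n (toℕ k) * u (toℕ k))
          ≈⟨ pascal-sum signedShiftedPower-step n ⟩
        t ^ n * u 0
          -- `u 0` computes to a product of three ones: two zeroth powers (0 choose 2 being 0) and
          -- an empty product.
          ≈⟨ solve 1 (λ y → y :* (con 1 :* con 1 :* con 1) := y) refl (t ^ n) ⟩
        t ^ n  ∎

  -- The sum equals `t ^ n` with `t * x ≈ a`, so multiplying the right side by `x ^ n` turns it into
  -- `a ^ n` over itself.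
  inverse-power-expansion : ∀ n a x q (a#0 : a # 0#) (x#0 : x # 0#) (q#0 : q # 0#)
    (nz : qPochhammer q n # 0#) →
    1# / x ^ n ⟨ ^-#0 n x#0 ⟩
      ≈ 1# / a ^ n ⟨ ^-#0 n a#0 ⟩
        * (∑[ k ≤ n ] ((- 1#) ^ toℕ k * q ^ (toℕ k C 2)
                        * qBinomial q n (toℕ k) (toℕ≤pred[n] k) nz
                        * shiftedPower x a q x#0 q#0 (toℕ k)))
  inverse-power-expansion n a x q a#0 x#0 q#0 nz =
    trans (/-unique (^-#0 n x#0) (begin
      a⁻ⁿ * t ^ n * x ^ n    ≈⟨ *-assoc a⁻ⁿ (t ^ n) (x ^ n) ⟩
      a⁻ⁿ * (t ^ n * x ^ n)  ≈⟨ *-congˡ (^-distrib-* t x n) ⟨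
      a⁻ⁿ * (t * x) ^ n      ≈⟨ *-congˡ (^-congˡ n (x/y*y≈x x#0)) ⟩
      a⁻ⁿ * a ^ n            ≈⟨ x/y*y≈x (^-#0 n a#0) ⟩
      1#                     ∎))
    (*-congˡ (sym (shiftedPower-sum q x#0 q#0 n nz)))
    where
    t = a / x ⟨ x#0 ⟩
    a⁻ⁿ = 1# / a ^ n ⟨ ^-#0 n a#0 ⟩

open import Defs

theorem5 : (n : ℕ) (a x ƛ : ℂ) (a#0 : a # 0ℂ) (x#0 : x # 0ℂ) (ƛ#0 : ƛ # 0ℂ)
    (nz : qPochhammer ƛ n # 0ℂ) →
    1ℂ / x ^ n ⟨ ^-#0 n x#0 ⟩
      ≈ 1ℂ / a ^ n ⟨ ^-#0 n a#0 ⟩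
        * (∑[ k ≤ n ] ((- 1ℂ) ^ toℕ k * ƛ ^ (toℕ k C 2)
                        * qBinomial ƛ n (toℕ k) (toℕ≤pred[n] k) nz
                        * shiftedPower x a ƛ x#0 ƛ#0 (toℕ k)))
theorem5 = QBinomialInversion.inverse-power-expansion Complex.heytingField
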